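{- Let $G=\langle V,E,S,D,L\rangle$ be a labeled multistage graph, let $|V|$ be the number of vertices and $|E|$ the number of edges in $G$. The time complexity of the Z-H algorithm (on input $G$) is a polynomial function of $|V|\cdot|E|$.
   Context: A labeled multistage graph $G=\langle V,E,S,D,L\rangle$ is a directed graph such that: (1) $V=V_0\cup V_1\cup\dots\cup V_L$ is the vertex set, with $V_i\cap V_j=\emptyset$ for $0\le i,j\le L$, $i\neq j$; a vertex $u\in V_i$ is said to be of stage $i$; (2) $E$ is the set of directed edges, each written as a triple $\langle u,v,l\rangle$ (an edge of stage $l$), where $1\le l\le L$, $u\in V_{l-1}$, $v\in V_l$; (3) $V_0=\{S\}$ and $V_L=\{D\}$; (4) each $v\in V\setminus\{S\}$ is labeled with a subset $E(v)\subseteq E$. A simple path in $G$ is a path $S-u_1-\dots-u_l-\dots-u_L$ with $u_L=D$ such that for every $l\in\{1,\dots,L\}$ all edges on $S-u_1-\dots-u_l$ are contained in $E(u_l)$. Notation. For an edge set $ES\subseteq E$, $ES[i:j]$ is the set of all edges of $ES$ from stage $i$ to stage $j$ (empty if $i>j$). For $u,v\in V$, $[ES]_u^v$ is the set of $e\in ES$ such that $e$ is on a path $u-\dots-v$ all of whose edges are contained in $ES$. For each edge $e=\langle u,v,l\rangle\in E$ the algorithm maintains a set $R(e)=R(u,v,l)\subseteq E$; $R(E)=\{R(e)\mid e\in E\}$ is a global variable. Operator $\mathrm{Init}(R(u,v,l))$: (1) $ES\leftarrow\{\langle a,b,k\rangle\in E\mid l<k\le L,\ \langle u,v,l\rangle\in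 E(a)\cap E(b)\}$; (2) $R(u,v,l)\leftarrow[ES]_v^D$. Operator $\mathrm{Comp}(ES,v,R(E))$, for $ES\subseteq E$, $v\in V$, is the final value of $T$ in: (1) $T\leftarrow ES$; (2) for all $e=\langle a,b,k\rangle\in T$: if $[R(a,b,k)\cap T]_b^v$ contains no path from $b$ to $v$, then $T\leftarrow T\setminus\{e\}$; (3) $T\leftarrow[T]_S^v$; (4) repeat (2) and (3) until $T$ does not change any more. Operator $\mathrm{Change}(R(u,v,l))$: (1) for all $\langle a,b,k\rangle\in R(u,v,l)$, $l<k\le L$: if $\mathrm{Comp}\big([\{e\mid e=\langle c,d,kk\rangle\in E,\ kk<l,\ [R(e)\cap\mathrm{Comp}(E(b),b,R(E))]_d^b \text{ contains } \langle u,v,l\rangle \text{ and } \langle a,b,k\rangle\}]_S^u,\ u,\ R(E)\big)\neq\emptyset$, then $\langle a,b,k\rangle$ is kept in $R(u,v,l)$, else $\langle a,b,k\rangle$ is deleted from $R(u,v,l)$; (2) $R(u,v,l)\leftarrow[R(u,v,l)]_v^D$; (3) repeat (1) and (2) until $R(u,v,l)$ does not change any more. Z-H algorithm, input $G=\langle V,E,S,D,L\rangle$: 1. For all $e\in E$, generate $R(e)$ by $\mathrm{Init}$. 2. For $l=1$ to $L-1$: (2.1) for all edges $\langle u,v,l\rangle$ of stage $l$, call $\mathrm{Change}(R(u,v,l))$ to modify $R(u,v,l)$; (2.2) for all $v$ of stage $l$, $E(v)\leftarrow\mathrm{Comp}(E(v),v,R(E))$; (2.3) for all $\langle a,b,k\rangle\in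 E$ with $k\le l$, replace the part $R(a,b,k)[k+1:l]$ of $R(a,b,k)$ by $\bigcup_{v\in V_l}[R(a,b,k)\cap\mathrm{Comp}(E(v),v,R(E))]_b^v$, then set $R(a,b,k)\leftarrow[R(a,b,k)]_b^D$. 3. Repeat step 2 until no $R(u,v,l)$ in $R(E)$ changes any more. 4. If $\mathrm{Comp}(E(D),D,R(E))\neq\emptyset$, claim the existence of a simple path in $G$; otherwise claim that there is no simple path in $G$.
   Formalization: The graph is assumed to have at least one edge and every stage V_0,…,V_L to be nonempty; otherwise |V| or L can be arbitrarily large while |V|·|E| stays bounded, and the claim fails because the algorithm loops over the vertices and stages. -}

module Defs where

open import Data.Bool.Base using (Bool; true; false; not; _∧_; _∨_; if_then_else_)
open import Data.Fin.Base using (Fin; zero; suc; toℕ; fromℕ)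
import Data.Fin.Properties as Fin
open import Data.Fin.Subset using (Subset; _∈_; ⊥)
open import Data.List.Base using (List; []; _∷_)
open import Data.Nat.Base using (ℕ; zero; suc; _+_; _*_; _∸_; _≤_; _<_; _≤ᵇ_; _<ᵇ_; _≡ᵇ_; z≤n; s≤s)
import Data.Nat.Properties as ℕ
open import Data.Product.Base using (Σ; ∃; ∃₂; _×_; _,_; proj₁; proj₂; map₂)
open import Data.Sum.Base using (_⊎_; inj₁; inj₂)
open import Data.Vec.Base using (Vec; []; _∷_; lookup)
open import Data.Vec.Properties using ([]=⇒lookup; lookup⇒[]=)
open import Function.Bundles using (_⇔_; mk⇔; Equivalence)
open import Relation.Binary.PropositionalEquality
open import Relation.Nullary.Decidable using (does; yes; no)

------------------------------------------------------------------------
-- Labeled multistage graphs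

-- V = Fin ∣V∣ and E = Fin ∣E∣.  The stages V₀,…,V_L are the fibres of
-- `stage`, hence disjoint with union V; as the blocks of a partition they
-- are inhabited.  An edge ⟨u,v,l⟩ is determined by u and v, because l is
-- the stage of v; `edge-injective` makes E a set of such triples.
-- Only vertices other than S carry a label E(v): `label S` is a dummy.

record LabeledMultistageGraph : Set where
  field
    ∣V∣ ∣E∣ L : ℕ
    stage     : Fin ∣V∣ → Fin (suc L)
    src tgt   : Fin ∣E∣ → Fin ∣V∣
    S D       : Fin ∣V∣
    label     : Fin ∣V∣ → Subset ∣E∣

    stage-inhabited : ∀ l → ∃ λ v → stage v ≡ l
    stage-edge      : ∀ e → toℕ (stage (tgt e)) ≡ suc (toℕ (stage (src e)))
    edge-injective  : ∀ {e f} → src e ≡ src f → tgt e ≡ tgt f → e ≡ f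
    V₀≡[S]          : ∀ v → stage v ≡ zero ⇔ v ≡ S
    V-L≡[D]         : ∀ v → stage v ≡ fromℕ L ⇔ v ≡ D

------------------------------------------------------------------------
-- Cost semantics

-- `m t x` says: m can halt after exactly t elementary steps with result x.
-- A program need not halt.
--
-- The costs are those of a unit-cost random access machine: a word holds a
-- vertex, an edge, a stage, a Boolean or a pointer to an array, and `step`
-- marks one elementary operation on words.  Sets of edges or vertices are
-- Boolean arrays; arrays are never overwritten, so changing one entry is
-- charged for a full copy.

Timed : Set → Set₁
Timed A = ℕ → A → Set

step : ∀ {A} → A → Timed A
step x t y = t ≡ 1 × y ≡ x

infixl 1 _>>=_

_>>=_ : ∀ {A B} → Timed A → (A → Timed B) → Timed B
(m >>= f) t y = ∃₂ λ i j → ∃ λ x → m i x × f x j y × t ≡ i + j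

build : ∀ {A n} → (Fin n → Timed A) → Timed (Vec A n)
build {n = zero}  f = step []
build {n = suc n} f = do
  x  ← f zero
  xs ← build (λ i → f (suc i))
  step (x ∷ xs)

for : ∀ {A} n → (Fin n → A → Timed A) → A → Timed A
for zero    body x = step x
for (suc n) body x = do
  y ← body zero x
  z ← for n (λ i → body (suc i)) y
  step z

-- The body returns the new value together with whether it has changed.

data Repeat {A : Set} (body : A → Timed (A × Bool)) (x : A) : Timed A where
  done  : ∀ {t y} → body x t (y , false) → Repeat body x (suc t) y
  again : ∀ {s t y z} → body x s (y , true) → Repeat body y t z →
          Repeat body x (suc (s + t)) z

HaltsWithin : ∀ {A} → Timed A → ℕ → Set
HaltsWithin m b = (∃₂ λ t x → m t x) × (∀ t x → m t x → t ≤ b)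

read : ∀ {A n} → Vec A n → Fin n → Timed A
read xs i = step (lookup xs i)

same : ∀ {n} → Fin n → Fin n → Timed Bool
same i j = step (does (i Fin.≟ j))

write : ∀ {A n} → Vec A n → Fin n → A → Timed (Vec A n)
write xs i x = build λ j → do
  i≡j ← same i j
  y   ← read xs j
  step (if i≡j then x else y)

any : ∀ {n} → (Fin n → Timed Bool) → Timed Bool
any {n} f = for n body false
  where
  body : Fin n → Bool → Timed Bool
  body i b = do
    c ← f i
    step (c ∨ b)

_∩ₜ_ _∪ₜ_ : ∀ {n} → Subset n → Subset n → Timed (Subset n)
X ∩ₜ Y = build λ i → do
  x ← read X i
  y ← read Y i
  step (x ∧ y)

X ∪ₜ Y = build λ i → do
  x ← read X i
  y ← read Y i
  step (x ∨ y)

nonempty : ∀ {n} → Subset n → Timed Bool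
nonempty X = any (read X)

differ : ∀ {n} → Subset n → Subset n → Timed Bool
differ X Y = any λ i → do
  x ← read X i
  y ← read Y i
  step ((x ∧ not y) ∨ (not x ∧ y))

------------------------------------------------------------------------
-- The Z-H algorithm

-- `for all' loops follow the numbering of vertices and edges.

module _ (G : LabeledMultistageGraph) where
  open LabeledMultistageGraph G

  Vertex Edge : Set
  Vertex = Fin ∣V∣
  Edge   = Fin ∣E∣

  edgeStage : Edge → ℕ
  edgeStage e = toℕ (stage (tgt e))

  -- The values of R(E) and of the current labels E(v).
  RSets Labels : Set
  RSets  = Vec (Subset ∣E∣) ∣E∣
  Labels = Vec (Subset ∣E∣) ∣V∣

  -- The vertices reachable from u along edges of ES, each traversed from
  -- its `from`-end to its `to`-end.  Paths have at most L edges.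
  reachable : (from to : Edge → Vertex) → Subset ∣E∣ → Vertex → Timed (Subset ∣V∣)
  reachable from to ES u = do
    F₀ ← build (same u)
    for L (λ _ → expand) F₀
    where
    expand : Subset ∣V∣ → Timed (Subset ∣V∣)
    expand F = build λ w → do
      old ← read F w
      new ← any λ e → do
        e∈ES ← read ES e
        a    ← step (from e)
        a∈F  ← read F a
        b    ← step (to e)
        b≡w  ← same b w
        step (e∈ES ∧ a∈F ∧ b≡w)
      step (old ∨ new)

  -- [ES]_u^v; see `between-correct`.
  between : Vertex → Vertex → Subset ∣E∣ → Timed (Subset ∣E∣)
  between u v ES = do
    F ← reachable src tgt ES u
    B ← reachable tgt src ES v
    build λ e → do
      e∈ES ← read ES e
      a    ← step (src e)
      a∈F  ← read F a
      b    ← step (tgt e)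
      b∈B  ← read B b
      step (e∈ES ∧ a∈F ∧ b∈B)

  -- Whether ES contains a path from u to v (the trivial one if u ≡ v);
  -- see `hasPath-correct`.
  hasPath : Vertex → Vertex → Subset ∣E∣ → Timed Bool
  hasPath u v ES = do
    F ← reachable src tgt ES u
    read F v

  initR : Labels → Edge → Timed (Subset ∣E∣)
  initR EL e = do
    l  ← step (edgeStage e)
    ES ← build λ f → do
      k   ← step (edgeStage f)
      l<k ← step (l <ᵇ k)
      if l<k
        then (do
          a   ← step (src f)
          Ea  ← read EL a
          inA ← read Ea e
          b   ← step (tgt f)
          Eb  ← read EL b
          inB ← read Eb e
          step (inA ∧ inB))
        else step false
    v ← step (tgt e)
    between v D ES

  Comp : Subset ∣E∣ → Vertex → RSets → Timed (Subset ∣E∣)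
  Comp ES v R = Repeat body ES
    where
    prune : Edge → Subset ∣E∣ → Timed (Subset ∣E∣)
    prune e T = do
      e∈T ← read T e
      if e∈T
        then (do
          Re ← read R e
          X  ← Re ∩ₜ T
          b  ← step (tgt e)
          Y  ← between b v X
          ok ← hasPath b v Y
          if ok then step T else write T e false)
        else step T

    body : Subset ∣E∣ → Timed (Subset ∣E∣ × Bool)
    body T = do
      T₁      ← for ∣E∣ prune T
      T₂      ← between S v T₁
      changed ← differ T T₂
      step (T₂ , changed)

  -- The condition under which f = ⟨a,b,k⟩ is kept in R(e), e = ⟨u,v,l⟩.
  -- Pitfall: for l = 1 no edge has kk < l, so the operator, applied as it is
  -- defined, keeps nothing.
  keeps : Labels → RSets → Edge → Edge → Timed Bool
  keeps EL R e f = do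
    l   ← step (edgeStage e)
    b   ← step (tgt f)
    Eb  ← read EL b
    C   ← Comp Eb b R
    ES  ← build λ g → do
      kk   ← step (edgeStage g)
      kk<l ← step (kk <ᵇ l)
      if kk<l
        then (do
          Rg  ← read R g
          X   ← Rg ∩ₜ C
          d   ← step (tgt g)
          Y   ← between d b X
          e∈Y ← read Y e
          f∈Y ← read Y f
          step (e∈Y ∧ f∈Y))
        else step false
    u   ← step (src e)
    ES′ ← between S u ES
    T   ← Comp ES′ u R
    nonempty T

  Change : Labels → Edge → RSets → Timed RSets
  Change EL e = Repeat body
    where
    filter : Edge → RSets → Timed RSets
    filter f R = do
      Re   ← read R e
      f∈Re ← read Re f
      l    ← step (edgeStage e)
      k    ← step (edgeStage f)
      l<k  ← step (l <ᵇ k)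
      if f∈Re ∧ l<k
        then (do
          ok ← keeps EL R e f
          if ok
            then step R
            else (do
              Re′ ← write Re f false
              write R e Re′))
        else step R

    body : RSets → Timed (RSets × Bool)
    body R = do
      R₁      ← for ∣E∣ filter R
      Re₁     ← read R₁ e
      v       ← step (tgt e)
      Re₂     ← between v D Re₁
      R₂      ← write R₁ e Re₂
      Re      ← read R e
      changed ← differ Re Re₂
      step (R₂ , changed)

  -- Step 2.1 for stage l.
  changeStage : ℕ → Labels → RSets → Timed RSets
  changeStage l EL = for ∣E∣ λ e R → do
    k   ← step (edgeStage e)
    k≡l ← step (k ≡ᵇ l)
    if k≡l then Change EL e R else step R

  -- Step 2.2 for stage l.
  compStage : ℕ → RSets → Labels → Timed Labels
  compStage l R = for ∣V∣ λ v EL → do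
    k   ← step (toℕ (stage v))
    k≡l ← step (k ≡ᵇ l)
    if k≡l
      then (do
        Ev  ← read EL v
        Ev′ ← Comp Ev v R
        write EL v Ev′)
      else step EL

  -- Step 2.3 for stage l.
  updateStage : ℕ → Labels → RSets → Timed RSets
  updateStage l EL = for ∣E∣ λ e R → do
    k   ← step (edgeStage e)
    k≤l ← step (k ≤ᵇ l)
    if k≤l then update e k R else step R
    where
    -- ⋃_{v ∈ V_l} [R(e) ∩ Comp(E(v),v,R(E))]_b^v
    union : Edge → RSets → Timed (Subset ∣E∣)
    union e R = for ∣V∣ addVertex ⊥
      where
      addVertex : Vertex → Subset ∣E∣ → Timed (Subset ∣E∣)
      addVertex v U = do
        i   ← step (toℕ (stage v))
        i≡l ← step (i ≡ᵇ l)
        if i≡l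
          then (do
            Re ← read R e
            Ev ← read EL v
            C  ← Comp Ev v R
            X  ← Re ∩ₜ C
            b  ← step (tgt e)
            Y  ← between b v X
            U ∪ₜ Y)
          else step U

    update : Edge → ℕ → RSets → Timed RSets
    update e k R = do
      Re  ← read R e
      U   ← union e R
      Re₁ ← build λ f → do
        i    ← step (edgeStage f)
        k<i  ← step (k <ᵇ i)
        i≤l  ← step (i ≤ᵇ l)
        f∈Re ← read Re f
        f∈U  ← read U f
        step (f∈U ∨ (f∈Re ∧ not (k<i ∧ i≤l)))
      b   ← step (tgt e)
      Re₂ ← between b D Re₁
      write R e Re₂

  -- Step 2.
  sweep : RSets × Labels → Timed (RSets × Labels)
  sweep = for (L ∸ 1) λ i (R , EL) → do
    l   ← step (suc (toℕ i))
    R₁  ← changeStage l EL R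
    EL₁ ← compStage l R₁ EL
    R₂  ← updateStage l EL₁ R₁
    step (R₂ , EL₁)

  sweepBody : RSets × Labels → Timed ((RSets × Labels) × Bool)
  sweepBody (R , EL) = do
    (R′ , EL′) ← sweep (R , EL)
    changed    ← any λ e → do
      Re  ← read R e
      Re′ ← read R′ e
      differ Re Re′
    step ((R′ , EL′) , changed)

  -- The result `true` claims the existence of a simple path.
  ZH : Timed Bool
  ZH = do
    EL        ← build (λ v → step (label v))
    R         ← build (initR EL)
    (R′ , EL′) ← Repeat sweepBody (R , EL)
    ED        ← read EL′ D
    T         ← Comp ED D R′
    nonempty T

------------------------------------------------------------------------
-- Polynomials in one variable, as lists of coefficients (constant first)

⟦_⟧ : List ℕ → ℕ → ℕ
⟦ []    ⟧ n = 0
⟦ a ∷ p ⟧ n = a + n * ⟦ p ⟧ n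

------------------------------------------------------------------------
-- Reachability computes the sets of edges on paths

module _ (G : LabeledMultistageGraph) where
  open LabeledMultistageGraph G

  -- Stages increase along edges, so walks have no repeated vertices.
  data Path (ES : Subset ∣E∣) : Vertex G → Vertex G → Set where
    []   : ∀ {u} → Path ES u u
    cons : ∀ e {v} → e ∈ ES → Path ES (tgt e) v → Path ES (src e) v

  data _∈edges_ {ES : Subset ∣E∣} (e : Edge G) : ∀ {u v} → Path ES u v → Set where
    here  : ∀ {v} {e∈ES : e ∈ ES} {p : Path ES (tgt e) v} → e ∈edges cons e e∈ES p
    there : ∀ {f v} {f∈ES : f ∈ ES} {p : Path ES (tgt f) v} → e ∈edges p →
            e ∈edges cons f f∈ES p

  OnPath : Subset ∣E∣ → Vertex G → Vertex G → Edge G → Set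
  OnPath ES u v e = ∃ λ (p : Path ES u v) → e ∈edges p

Post : ∀ {A} → Timed A → (A → Set) → Set
Post m P = ∀ {t x} → m t x → P x

private
  ∧-true : ∀ {a b} → a ∧ b ≡ true → a ≡ true × b ≡ true
  ∧-true {true} {true} _ = refl , refl

  ∨-true : ∀ {a b} → a ∨ b ≡ true → a ≡ true ⊎ b ≡ true
  ∨-true {true}  _ = inj₁ refl
  ∨-true {false} p = inj₂ p

  ∨-trueʳ : ∀ a {b} → b ≡ true → a ∨ b ≡ true
  ∨-trueʳ true  _ = refl
  ∨-trueʳ false p = p

  same-true : ∀ {n} (i j : Fin n) → does (i Fin.≟ j) ≡ true → i ≡ j
  same-true i j q with i Fin.≟ j
  ... | yes p = p

  same-refl : ∀ {n} (i : Fin n) → does (i Fin.≟ i) ≡ true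
  same-refl i with i Fin.≟ i
  ... | yes _ = refl
  ... | no ¬p with () ← ¬p refl

  build-post : ∀ {A n} {f : Fin n → Timed A} {P : Fin n → A → Set} →
               (∀ i → Post (f i) (P i)) → Post (build f) (λ xs → ∀ i → P i (lookup xs i))
  build-post h (_ , _ , _ , p , (_ , _ , _ , q , (_ , refl) , _) , _) zero    = h zero p
  build-post h (_ , _ , _ , p , (_ , _ , _ , q , (_ , refl) , _) , _) (suc i) =
    build-post (λ j → h (suc j)) q i

  for-post : ∀ {A} n {body : A → Timed A} {P : ℕ → A → Set} →
             (∀ i {x} → P i x → Post (body x) (P (suc i))) →
             ∀ i {x} → P i x → Post (for n (λ _ → body) x) (P (n + i))
  for-post zero    h i p (_ , refl) = p
  for-post (suc n) {P = P} h i p (_ , _ , _ , r , (_ , _ , z , s , (_ , refl) , _) , _) =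
    subst (λ k → P k z) (ℕ.+-suc n i) (for-post n {P = P} h (suc i) (h i p r) s)

  any-true : ∀ {n} {f : Fin n → Timed Bool} {P : Fin n → Set} →
             (∀ i → Post (f i) (λ b → b ≡ true ⇔ P i)) →
             Post (any f) (λ b → b ≡ true ⇔ ∃ P)
  any-true {f = f} {P} h r = mk⇔ to (λ p → go₂ h r (inj₂ p))
    where
    body : ∀ {n} → (Fin n → Timed Bool) → Fin n → Bool → Timed Bool
    body f i b = f i >>= λ c → step (c ∨ b)

    go₁ : ∀ {n} {f : Fin n → Timed Bool} {P : Fin n → Set} →
          (∀ i → Post (f i) (λ b → b ≡ true ⇔ P i)) → ∀ {b₀} →
          Post (for n (body f) b₀) (λ b → b ≡ true → b₀ ≡ true ⊎ ∃ P)
    go₁ {zero}  h (_ , refl) q = inj₁ q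
    go₁ {suc n} h (_ , _ , _ , (_ , _ , c , fc , (_ , refl) , _) , (_ , _ , _ , s , (_ , refl) , _) , _) q
      with go₁ (λ i → h (suc i)) s q
    ... | inj₂ (i , p) = inj₂ (suc i , p)
    ... | inj₁ c∨b with ∨-true {c} c∨b
    ...   | inj₁ c≡true = inj₂ (zero , Equivalence.to (h zero fc) c≡true)
    ...   | inj₂ b≡true = inj₁ b≡true

    go₂ : ∀ {n} {f : Fin n → Timed Bool} {P : Fin n → Set} →
          (∀ i → Post (f i) (λ b → b ≡ true ⇔ P i)) → ∀ {b₀} →
          Post (for n (body f) b₀) (λ b → b₀ ≡ true ⊎ ∃ P → b ≡ true)
    go₂ {zero}  h (_ , refl) (inj₁ q) = q
    go₂ {suc n} h (_ , _ , _ , (_ , _ , c , fc , (_ , refl) , _) , (_ , _ , _ , s , (_ , refl) , _) , _) p =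
      go₂ (λ i → h (suc i)) s (next p)
      where
      next : _ → _
      next (inj₁ b≡true)      = inj₁ (∨-trueʳ c b≡true)
      next (inj₂ (zero  , p)) = inj₁ (cong (_∨ _) (Equivalence.from (h zero fc) p))
      next (inj₂ (suc i , p)) = inj₂ (i , p)

    to : _ ≡ true → ∃ P
    to q with go₁ h r q
    ... | inj₂ p = p

module _ (G : LabeledMultistageGraph) where
  open LabeledMultistageGraph G

  private
    data Chain (from to : Edge G → Vertex G) (ES : Subset ∣E∣) (u : Vertex G) :
               ℕ → Vertex G → Set where
      []   : Chain from to ES u 0 u
      snoc : ∀ {n} e → Chain from to ES u n (from e) → e ∈ ES →
             Chain from to ES u (suc n) (to e)

    Within : (from to : Edge G → Vertex G) → Subset ∣E∣ → Vertex G → ℕ → Subset ∣V∣ → Set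
    Within from to ES u n F =
      ∀ w → lookup F w ≡ true ⇔ ∃ λ k → k ≤ n × Chain from to ES u k w

    reachable-within : ∀ from to ES u →
      Post (reachable G from to ES u) (Within from to ES u L)
    reachable-within from to ES u {x = F} (_ , _ , F₀ , b , r , _) =
      subst (λ k → Within from to ES u k F) (ℕ.+-identityʳ L)
        (for-post L {P = Within from to ES u} grow 0 start r)
      where
      start : Within from to ES u 0 F₀
      start w with build-post {P = λ i b → b ≡ does (u Fin.≟ i)} (λ i → λ { (_ , q) → q }) b w
      ... | eq = mk⇔ fwd bwd
        where
        fwd : _
        fwd q with refl ← same-true u w (trans (sym eq) q) = 0 , z≤n , []
        bwd : (∃ λ k → k ≤ 0 × Chain from to ES u k w) → lookup F₀ w ≡ true
        bwd (_ , _ , []) = trans eq (same-refl u)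

      Hit : Subset ∣V∣ → Vertex G → Edge G → Set
      Hit F w e = e ∈ ES × lookup F (from e) ≡ true × to e ≡ w

      grow : ∀ i {F} → Within from to ES u i F → Post _ (Within from to ES u (suc i))
      grow i {F} h {x = F′} r w = mk⇔ fwd bwd
        where
        new : lookup F′ w ≡ true ⇔ (lookup F w ≡ true ⊎ ∃ (Hit F w))
        new = build-post {P = λ w b → b ≡ true ⇔ (lookup F w ≡ true ⊎ ∃ (Hit F w))} each r w
          where
          each : ∀ w → Post _ (λ b → b ≡ true ⇔ (lookup F w ≡ true ⊎ ∃ (Hit F w)))
          each w (_ , _ , old , (_ , refl) , (_ , _ , found , a , (_ , refl) , _) , _) =
            mk⇔ (λ q → case (∨-true {old} q))
                (λ { (inj₁ q) → cong (_∨ found) q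
                   ; (inj₂ q) → ∨-trueʳ old (Equivalence.from hits q) })
            where
            hit : ∀ e → Post _ (λ b → b ≡ true ⇔ Hit F w e)
            hit e ( _ , _ , _ , (_ , refl)
                  , (_ , _ , _ , (_ , refl)
                  , (_ , _ , _ , (_ , refl)
                  , (_ , _ , _ , (_ , refl)
                  , (_ , _ , _ , (_ , refl) , (_ , refl) , _) , _) , _) , _) , _) =
              mk⇔ (λ q → let (x , yz) = ∧-true {lookup ES e} q
                             (y , z)  = ∧-true {lookup F (from e)} yz
                         in lookup⇒[]= e ES x , y , same-true (to e) w z)
                  (λ { (x , y , refl) →
                       cong₂ _∧_ ([]=⇒lookup x) (cong₂ _∧_ y (same-refl (to e))) })
            hits : found ≡ true ⇔ ∃ (Hit F w)
            hits = any-true {P = Hit F w} hit a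
            case : _ → _
            case (inj₁ q) = inj₁ q
            case (inj₂ q) = inj₂ (Equivalence.to hits q)

        fwd : lookup F′ w ≡ true → ∃ λ k → k ≤ suc i × Chain from to ES u k w
        fwd q with Equivalence.to new q
        ... | inj₁ old = let (k , k≤i , c) = Equivalence.to (h w) old
                         in k , ℕ.m≤n⇒m≤1+n k≤i , c
        ... | inj₂ (e , e∈ES , a∈F , refl) =
              let (k , k≤i , c) = Equivalence.to (h (from e)) a∈F
              in suc k , s≤s k≤i , snoc e c e∈ES

        bwd : (∃ λ k → k ≤ suc i × Chain from to ES u k w) → lookup F′ w ≡ true
        bwd (_ , _ , []) =
          Equivalence.from new (inj₁ (Equivalence.from (h w) (0 , z≤n , [])))
        bwd (_ , s≤s k≤i , snoc e c e∈ES) =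
          Equivalence.from new
            (inj₂ (e , e∈ES , Equivalence.from (h (from e)) (_ , k≤i , c) , refl))

    stage≤L : ∀ v → toℕ (stage v) ≤ L
    stage≤L v = Fin.toℕ≤pred[n] (stage v)

    chain→path : ∀ {ES u n w v} → Chain src tgt ES u n w → Path G ES w v → Path G ES u v
    chain→path []               p = p
    chain→path (snoc e c e∈ES) p = chain→path c (cons e e∈ES p)

    path→chain : ∀ {ES u n w v} → Chain src tgt ES u n w → Path G ES w v →
                 ∃ λ m → Chain src tgt ES u m v
    path→chain c []              = _ , c
    path→chain c (cons e e∈ES p) = path→chain (snoc e c e∈ES) p

    chain-stage : ∀ {ES u n w} → Chain src tgt ES u n w →
                  n + toℕ (stage u) ≡ toℕ (stage w)
    chain-stage []            = refl
    chain-stage (snoc e c _) = trans (cong suc (chain-stage c)) (sym (stage-edge e))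

    forward : ∀ {ES u} → Post (reachable G src tgt ES u)
              (λ F → ∀ w → lookup F w ≡ true ⇔ Path G ES u w)
    forward {ES} {u} r w = mk⇔
      (λ q → let (_ , _ , c) = Equivalence.to (reachable-within src tgt ES u r w) q
             in chain→path c [])
      (λ p → let (m , c) = path→chain [] p in
             Equivalence.from (reachable-within src tgt ES u r w)
               (m , ℕ.≤-trans (ℕ.m≤m+n m _)
                      (ℕ.≤-trans (ℕ.≤-reflexive (chain-stage c)) (stage≤L w)) , c))

    unchain : ∀ {ES u n w} → Chain tgt src ES u n w → Path G ES w u
    unchain []              = []
    unchain (snoc e c e∈ES) = cons e e∈ES (unchain c)

    rechain : ∀ {ES w u} → Path G ES w u →
              ∃ λ n → Chain tgt src ES u n w × n + toℕ (stage w) ≡ toℕ (stage u)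
    rechain []              = 0 , [] , refl
    rechain (cons e e∈ES p) =
      let (n , c , q) = rechain p
      in suc n , snoc e c e∈ES ,
         trans (sym (ℕ.+-suc n _)) (trans (cong (n +_) (sym (stage-edge e))) q)

    backward : ∀ {ES v} → Post (reachable G tgt src ES v)
               (λ B → ∀ w → lookup B w ≡ true ⇔ Path G ES w v)
    backward {ES} {v} r w = mk⇔
      (λ q → let (_ , _ , c) = Equivalence.to (reachable-within tgt src ES v r w) q
             in unchain c)
      (λ p → let (m , c , s) = rechain p in
             Equivalence.from (reachable-within tgt src ES v r w)
               (m , ℕ.≤-trans (ℕ.m≤m+n m _)
                      (ℕ.≤-trans (ℕ.≤-reflexive s) (stage≤L v)) , c))

    join : ∀ {ES u v e} → Path G ES u (src e) → e ∈ ES → Path G ES (tgt e) v → OnPath G ES u v e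
    join []               e∈ES q = cons _ e∈ES q , here
    join (cons f f∈ES p) e∈ES q = let (r , i) = join p e∈ES q in cons f f∈ES r , there i

    split : ∀ {ES u v e} {p : Path G ES u v} → _∈edges_ G e p →
            e ∈ ES × Path G ES u (src e) × Path G ES (tgt e) v
    split {p = cons e e∈ES p} here      = e∈ES , [] , p
    split {p = cons f f∈ES p} (there i) =
      let (e∈ES , q , r) = split i in e∈ES , cons f f∈ES q , r

  hasPath-correct : ∀ {ES u v} → Post (hasPath G u v ES) (λ b → b ≡ true ⇔ Path G ES u v)
  hasPath-correct {v = v} (_ , _ , _ , r , (_ , refl) , _) = forward r v

  between-correct : ∀ {ES u v} →
    Post (between G u v ES) (λ X → ∀ e → e ∈ X ⇔ OnPath G ES u v e)
  between-correct {ES} {u} {v} {x = X} (_ , _ , F , f , (_ , _ , B , b , r , _) , _) e = mk⇔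
    (λ e∈X → let (e∈ES , p , q) = Equivalence.to bits ([]=⇒lookup e∈X) in join p e∈ES q)
    (λ (_ , i) → lookup⇒[]= e X (Equivalence.from bits (split i)))
    where
    Bits : Edge G → Bool → Set
    Bits e x = x ≡ true ⇔ (e ∈ ES × Path G ES u (src e) × Path G ES (tgt e) v)

    bits : Bits e (lookup X e)
    bits = build-post {P = Bits} each r e
      where
      each : ∀ e → Post _ (Bits e)
      each e ( _ , _ , _ , (_ , refl)
             , (_ , _ , _ , (_ , refl)
             , (_ , _ , _ , (_ , refl)
             , (_ , _ , _ , (_ , refl)
             , (_ , _ , _ , (_ , refl) , (_ , refl) , _) , _) , _) , _) , _) = mk⇔
        (λ q → let (x , yz) = ∧-true {lookup ES e} q
                   (y , z)  = ∧-true {lookup F (src e)} yz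
               in lookup⇒[]= e ES x , Equivalence.to (forward f _) y
                                    , Equivalence.to (backward b _) z)
        (λ (x , y , z) → cong₂ _∧_ ([]=⇒lookup x)
                           (cong₂ _∧_ (Equivalence.from (forward f _) y)
                                      (Equivalence.from (backward b _) z)))

{-# OPTIONS --safe #-}

-- Every loop is bounded by ∣V∣ or ∣E∣, except for the `Repeat`s. In each of
-- those, some edge set only ever loses edges and a pass that reports a change
-- has removed one: the set T in Comp, the set R(e) in Change(R(e)), and the
-- disjoint union of all the R(e) in step 3. So there are at most ∣E∣ + 1,
-- ∣E∣ + 1 and ∣E∣² + 1 passes, and nesting the loops multiplies polynomials.
module Submission where

open import Defs
open import Data.Bool.Base using (Bool; true; false; not; _∧_; _∨_; if_then_else_)
open import Data.Fin.Base using (Fin; zero; suc; toℕ)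
import Data.Fin.Properties as Fin
open import Data.Fin.Subset using (Subset; _∈_; _⊆_; ⊥; ∣_∣)
import Data.Fin.Subset.Properties as Subset
open import Data.List.Base using (List; []; _∷_; map)
open import Data.Nat.Base using (ℕ; zero; suc; _+_; _*_; _≤_; _<_; _<ᵇ_; _≤ᵇ_; _≡ᵇ_; z≤n; s≤s; >-nonZero)
import Data.Nat.Properties as ℕ
open import Data.Nat.Tactic.RingSolver using (solve-∀)
open import Data.Product.Base using (∃; ∃₂; _×_; _,_; proj₁; proj₂)
open import Data.Unit.Base using (⊤; tt)
open import Data.Vec.Base using (Vec; []; _∷_; lookup; sum)
import Data.Vec.Base as Vec
open import Data.Vec.Properties using ([]=⇒lookup; lookup⇒[]=)
open import Function.Base using (_∘_; _$_; id)
open import Function.Bundles using (Equivalence)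
open import Relation.Binary.PropositionalEquality
open import Relation.Nullary.Decidable using (does; yes; no)
open import Relation.Nullary.Negation using (contradiction)

-- Arithmetic of coefficient lists.

infixl 6 _+ᵖ_
infixl 7 _*ᵖ_

_+ᵖ_ : List ℕ → List ℕ → List ℕ
[]      +ᵖ q       = q
(a ∷ p) +ᵖ []      = a ∷ p
(a ∷ p) +ᵖ (b ∷ q) = a + b ∷ p +ᵖ q

_*ᵖ_ : List ℕ → List ℕ → List ℕ
[]      *ᵖ q = []
(a ∷ p) *ᵖ q = map (a *_) q +ᵖ (0 ∷ p *ᵖ q)

⟦+ᵖ⟧ : ∀ p q n → ⟦ p +ᵖ q ⟧ n ≡ ⟦ p ⟧ n + ⟦ q ⟧ n
⟦+ᵖ⟧ []      q       n = refl
⟦+ᵖ⟧ (a ∷ p) []      n = sym (ℕ.+-identityʳ _)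
⟦+ᵖ⟧ (a ∷ p) (b ∷ q) n rewrite ⟦+ᵖ⟧ p q n = lemma a b n (⟦ p ⟧ n) (⟦ q ⟧ n)
  where
  lemma : ∀ a b n x y → a + b + n * (x + y) ≡ a + n * x + (b + n * y)
  lemma = solve-∀

⟦map-*⟧ : ∀ a q n → ⟦ map (a *_) q ⟧ n ≡ a * ⟦ q ⟧ n
⟦map-*⟧ a []      n = sym (ℕ.*-zeroʳ a)
⟦map-*⟧ a (b ∷ q) n rewrite ⟦map-*⟧ a q n = lemma a b n (⟦ q ⟧ n)
  where
  lemma : ∀ a b n y → a * b + n * (a * y) ≡ a * (b + n * y)
  lemma = solve-∀

⟦*ᵖ⟧ : ∀ p q n → ⟦ p *ᵖ q ⟧ n ≡ ⟦ p ⟧ n * ⟦ q ⟧ n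
⟦*ᵖ⟧ []      q n = refl
⟦*ᵖ⟧ (a ∷ p) q n
  rewrite ⟦+ᵖ⟧ (map (a *_) q) (0 ∷ p *ᵖ q) n | ⟦map-*⟧ a q n | ⟦*ᵖ⟧ p q n
  = lemma a n (⟦ p ⟧ n) (⟦ q ⟧ n)
  where
  lemma : ∀ a n x y → a * y + n * (x * y) ≡ (a + n * x) * y
  lemma = solve-∀

-- Formal cost expressions and their polynomial bounds.

infixl 6 _⊕_
infixl 7 _⊗_
infix  5 _at_

-- Time bounds are formal expressions, so that Agda infers them by unification
-- from the structure of the programs.
data Cost : Set where
  con     : ℕ → Cost
  #V #E   : Cost
  _⊕_ _⊗_ : Cost → Cost → Cost

_at_ : Cost → LabeledMultistageGraph → ℕ
con k at G = k
#V    at G = LabeledMultistageGraph.∣V∣ G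
#E    at G = LabeledMultistageGraph.∣E∣ G
c ⊕ d at G = (c at G) + (d at G)
c ⊗ d at G = (c at G) * (d at G)

-- Both `#V` and `#E` become the one variable, which stands for the product of the two counts. The
-- result is therefore an upper bound for the cost, not its exact value.
polynomial : Cost → List ℕ
polynomial (con k) = k ∷ []
polynomial #V      = 0 ∷ 1 ∷ []
polynomial #E      = 0 ∷ 1 ∷ []
polynomial (c ⊕ d) = polynomial c +ᵖ polynomial d
polynomial (c ⊗ d) = polynomial c *ᵖ polynomial d

-- Fits both `build` and `for`: the outer 1 pays for the `step` of the empty loop, the inner 1 for
-- the `step` that closes each iteration.
loop : Cost → Cost → Cost
loop s c = con 1 ⊕ s ⊗ (c ⊕ con 1)

⟦X⟧ : ∀ n → ⟦ 0 ∷ 1 ∷ [] ⟧ n ≡ n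
⟦X⟧ n rewrite ℕ.*-zeroʳ n = ℕ.*-identityʳ n

module _ (G : LabeledMultistageGraph) where
  open LabeledMultistageGraph G

  -- A positive product has no zero factor, so each count is at most the product. Sums and products
  -- then follow by monotonicity.
  at≤polynomial : 1 ≤ ∣V∣ * ∣E∣ → ∀ c → c at G ≤ ⟦ polynomial c ⟧ (∣V∣ * ∣E∣)
  at≤polynomial pos = go
    where
    n = ∣V∣ * ∣E∣
    go : ∀ c → c at G ≤ ⟦ polynomial c ⟧ n
    go (con k) = ℕ.m≤m+n k _
    go #V rewrite ⟦X⟧ n = ℕ.m≤m*n ∣V∣ ∣E∣ {{ℕ.m*n≢0⇒n≢0 ∣V∣ {{>-nonZero pos}}}}
    go #E rewrite ⟦X⟧ n = ℕ.m≤n*m ∣E∣ ∣V∣ {{ℕ.m*n≢0⇒m≢0 ∣V∣ {{>-nonZero pos}}}}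
    go (c ⊕ d) rewrite ⟦+ᵖ⟧ (polynomial c) (polynomial d) n = ℕ.+-mono-≤ (go c) (go d)
    go (c ⊗ d) rewrite ⟦*ᵖ⟧ (polynomial c) (polynomial d) n = ℕ.*-mono-≤ (go c) (go d)

  -- Choosing a vertex in every stage is injective, because `stage` recovers the index. This lets
  -- loops with `L` or `L ∸ 1` iterations be charged to `#V`.
  1+L≤∣V∣ : suc L ≤ ∣V∣
  1+L≤∣V∣ = Fin.injective⇒≤ {f = proj₁ ∘ stage-inhabited} λ {l} {m} eq →
    trans (sym (proj₂ (stage-inhabited l)))
          (trans (cong stage eq) (proj₂ (stage-inhabited m)))

  L≤∣V∣ : L ≤ ∣V∣
  L≤∣V∣ = ℕ.<⇒≤ 1+L≤∣V∣

-- A program logic for halting, time and postconditions.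

record Runs (G : LabeledMultistageGraph) {A : Set} (m : Timed A) (c : Cost) (P : A → Set) : Set where
  field
    halts : ∃₂ λ t x → m t x
    bound : ∀ {t x} → m t x → t ≤ c at G
    post  : Post m P

open Runs

Halts : (G : LabeledMultistageGraph) {A : Set} → Timed A → Cost → Set
Halts G m c = Runs G m c (λ _ → ⊤)

module _ {G : LabeledMultistageGraph} where

  weaken : ∀ {A} {m : Timed A} {c P Q} → (∀ {x} → P x → Q x) → Runs G m c P → Runs G m c Q
  weaken P⊆Q r = record { halts = halts r ; bound = bound r ; post = λ e → P⊆Q (post r e) }

  return : ∀ {A} {x : A} {P : A → Set} → P x → Runs G (step x) (con 1) P
  return px = record
    { halts = _ , _ , refl , refl
    ; bound = λ { (refl , _) → ℕ.≤-refl }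
    ; post  = λ { (_ , refl) → px }
    }

  -- Halting, time and postcondition travel together because the continuation halts in time only on
  -- results satisfying `P`. Its cost `d` is the same for all those results, so the total remains a
  -- closed expression.
  bind : ∀ {A B} {m : Timed A} {f : A → Timed B} {c d P Q} →
         Runs G m c P → (∀ x → P x → Runs G (f x) d Q) → Runs G (m >>= f) (c ⊕ d) Q
  bind r s = record
    { halts = let (_ , x , e) = halts r
                  (_ , y , e′) = halts (s x (post r e))
              in _ , y , _ , _ , x , e , e′ , refl
    ; bound = λ { (_ , _ , x , e , e′ , refl) →
                    ℕ.+-mono-≤ (bound r e) (bound (s x (post r e)) e′) }
    ; post  = λ { (_ , _ , x , e , e′ , refl) → post (s x (post r e)) e′ }
    }

  tick : ∀ {A B} {x : A} {f : A → Timed B} {d Q} →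
         Runs G (f x) d Q → Runs G (step x >>= f) (con 1 ⊕ d) Q
  tick {x = x} r = bind {P = _≡ x} (return refl) λ { _ refl → r }

  -- The sum replaces the maximum of the two costs, so bounds never leave the language of sums and
  -- products.
  branch : ∀ {A} b {m m′ : Timed A} {c d P} →
           Runs G m c P → Runs G m′ d P → Runs G (if b then m else m′) (c ⊕ d) P
  branch true  r s = record
    { halts = halts r ; bound = λ e → ℕ.m≤n⇒m≤n+o _ (bound r e) ; post = post r }
  branch false r s = record
    { halts = halts s ; bound = λ e → ℕ.m≤n⇒m≤o+n _ (bound s e) ; post = post s }

  private
    one-more : ∀ n c → c + ((1 + n * (c + 1)) + 1) ≡ 1 + (suc n) * (c + 1)
    one-more = solve-∀

    loop-mono : ∀ {n} s c → n ≤ s at G → 1 + n * ((c at G) + 1) ≤ (loop s c at G)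
    loop-mono s c n≤s = s≤s (ℕ.*-monoˡ-≤ ((c at G) + 1) n≤s)

  build-runs : ∀ {A n} {f : Fin n → Timed A} {c} {P : Fin n → A → Set} s → n ≤ s at G →
               (∀ i → Runs G (f i) c (P i)) →
               Runs G (build f) (loop s c) (λ xs → ∀ i → P i (lookup xs i))
  build-runs {c = c} s n≤s r = record
    { halts = run r
    ; bound = λ e → ℕ.≤-trans (time r e) (loop-mono s c n≤s)
    ; post  = result r
    }
    where
    run : ∀ {A n} {f : Fin n → Timed A} {P : Fin n → A → Set} →
          (∀ i → Runs G (f i) c (P i)) → ∃₂ (build f)
    run {n = zero}  r = _ , _ , refl , refl
    run {n = suc n} r =
      let (_ , x , e)   = halts (r zero)
          (_ , xs , e′) = run (r ∘ suc)
      in _ , _ , _ , _ , x , e , (_ , _ , xs , e′ , (refl , refl) , refl) , refl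

    time : ∀ {A n} {f : Fin n → Timed A} {P : Fin n → A → Set} →
           (∀ i → Runs G (f i) c (P i)) → ∀ {t xs} → build f t xs → t ≤ 1 + n * ((c at G) + 1)
    time {n = zero}  r (refl , _) = ℕ.≤-refl
    time {n = suc n} r (_ , _ , _ , e , (_ , _ , _ , e′ , (refl , _) , refl) , refl) =
      ℕ.≤-trans (ℕ.+-mono-≤ (bound (r zero) e) (ℕ.+-monoˡ-≤ 1 (time (r ∘ suc) e′)))
                (ℕ.≤-reflexive (one-more n (c at G)))

    result : ∀ {A n} {f : Fin n → Timed A} {P : Fin n → A → Set} →
             (∀ i → Runs G (f i) c (P i)) → Post (build f) (λ xs → ∀ i → P i (lookup xs i))
    result r (_ , _ , _ , e , (_ , _ , _ , _  , (_ , refl) , _) , _) zero    = post (r zero) e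
    result r (_ , _ , _ , _ , (_ , _ , _ , e′ , (_ , refl) , _) , _) (suc i) = result (r ∘ suc) e′ i

  build-halts : ∀ {A n} {f : Fin n → Timed A} {c} s → n ≤ s at G →
                (∀ i → Halts G (f i) c) → Halts G (build f) (loop s c)
  build-halts s n≤s r = weaken _ (build-runs {P = λ _ _ → ⊤} s n≤s r)

  for-runs : ∀ {A n} {body : Fin n → A → Timed A} {c} {P : A → Set} s → n ≤ s at G →
             (∀ i x → P x → Runs G (body i x) c P) →
             ∀ {x} → P x → Runs G (for n body x) (loop s c) P
  for-runs {A} {c = c} {P} s n≤s r px = record
    { halts = run r px
    ; bound = λ e → ℕ.≤-trans (time r px e) (loop-mono s c n≤s)
    ; post  = result r px
    }
    where
    Preserved : ∀ {n} → (Fin n → A → Timed A) → Set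
    Preserved body = ∀ i x → P x → Runs G (body i x) c P

    run : ∀ {n} {body : Fin n → A → Timed A} → Preserved body → ∀ {x} → P x → ∃₂ (for n body x)
    run {zero}  r px = _ , _ , refl , refl
    run {suc n} r px =
      let (_ , y , e)  = halts (r zero _ px)
          (_ , z , e′) = run (r ∘ suc) (post (r zero _ px) e)
      in _ , _ , _ , _ , y , e , (_ , _ , z , e′ , (refl , refl) , refl) , refl

    time : ∀ {n} {body : Fin n → A → Timed A} → Preserved body → ∀ {x} → P x →
           ∀ {t y} → for n body x t y → t ≤ 1 + n * ((c at G) + 1)
    time {zero}  r px (refl , _) = ℕ.≤-refl
    time {suc n} r px (_ , _ , _ , e , (_ , _ , _ , e′ , (refl , _) , refl) , refl) =
      ℕ.≤-trans (ℕ.+-mono-≤ (bound (r zero _ px) e)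
                            (ℕ.+-monoˡ-≤ 1 (time (r ∘ suc) (post (r zero _ px) e) e′)))
                (ℕ.≤-reflexive (one-more n (c at G)))

    result : ∀ {n} {body : Fin n → A → Timed A} → Preserved body → ∀ {x} → P x → Post (for n body x) P
    result {zero}  r px (_ , refl) = px
    result {suc n} r px (_ , _ , _ , e , (_ , _ , _ , e′ , (_ , refl) , _) , _) =
      result (r ∘ suc) (post (r zero _ px) e) e′

  -- Every pass reporting a change lowers `μ`, so at most `s` such passes precede the last one. Each
  -- pass costs its body plus the `suc` in the constructors of `Repeat`.
  repeat-runs : ∀ {A} {body : A → Timed (A × Bool)} {c} {P : A → Set} s (μ : A → ℕ) →
                (∀ x → μ x ≤ s at G) →
                (∀ x → P x → Runs G (body x) c (λ (y , b) → P y × (b ≡ true → μ y < μ x))) →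
                ∀ {x} → P x → Runs G (Repeat body x) ((con 1 ⊕ s) ⊗ (con 1 ⊕ c)) P
  repeat-runs {A} {body = body} {c} {P} s μ μ≤s r {x} px = record
    { halts = run (μ x) px ℕ.≤-refl
    ; bound = λ e → ℕ.≤-trans (time px e) (ℕ.*-monoˡ-≤ (suc (c at G)) (s≤s (μ≤s x)))
    ; post  = result px
    }
    where
    -- The fuel `k` dominates the measure and makes the recursion structural; with no fuel left, a
    -- reported change would push the measure below 0.
    run : ∀ k {x} → P x → μ x ≤ k → ∃₂ (Repeat body x)
    run k px μ≤k with halts (r _ px)
    ... | _ , (y , false) , e = _ , _ , done e
    ... | _ , (y , true)  , e with k | post (r _ px) e
    ...   | zero  | _  , μ< = contradiction (ℕ.≤-trans (μ< refl) μ≤k) λ ()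
    ...   | suc k | py , μ< =
      let (_ , _ , e′) = run k py (ℕ.≤-pred (ℕ.≤-trans (μ< refl) μ≤k)) in _ , _ , again e e′

    -- Recursion is on the run itself. The bound uses `μ x` instead of the uniform `s`, since it has
    -- to drop from pass to pass.
    time : ∀ {x} → P x → ∀ {t y} → Repeat body x t y → t ≤ suc (μ x) * suc (c at G)
    time px (done e) = ℕ.≤-trans (s≤s (bound (r _ px) e)) (ℕ.m≤m+n _ _)
    time px (again e e′) =
      let (py , μ<) = post (r _ px) e in
      s≤s (ℕ.+-mono-≤ (bound (r _ px) e)
                      (ℕ.≤-trans (time py e′) (ℕ.*-monoˡ-≤ (suc (c at G)) (μ< refl))))

    result : ∀ {x} → P x → Post (Repeat body x) P
    result px (done e)     = proj₁ (post (r _ px) e)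
    result px (again e e′) = result (proj₁ (post (r _ px) e)) e′

  -- Through this witness a change test hands a differing position to the termination measures.
  any-runs : ∀ {n} {f : Fin n → Timed Bool} {c} {P : Fin n → Set} s → n ≤ s at G →
             (∀ i → Runs G (f i) c (λ b → b ≡ true → P i)) →
             Runs G (any f) (loop s (c ⊕ con 1)) (λ b → b ≡ true → ∃ P)
  any-runs s n≤s r = for-runs s n≤s
    -- The loop invariant is `b ≡ true → ∃ P`, vacuous for the initial `false`.
    (λ i b h → bind (r i) λ { true p → return (λ _ → i , p refl) ; false _ → return h }) λ ()

  any-halts : ∀ {n} {f : Fin n → Timed Bool} {c} s → n ≤ s at G →
              (∀ i → Halts G (f i) c) →
              Halts G (any f) (loop s (c ⊕ con 1))
  any-halts s n≤s r = for-runs s n≤s (λ i b _ → bind (r i) λ _ _ → return tt) tt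

-- Inclusion and cardinality of sets and of families of sets.

∧-trueˡ : ∀ {a b} → a ∧ b ≡ true → a ≡ true
∧-trueˡ {true} _ = refl

-- The shape of an entry assembled in step 2.3: `a` is membership in the union, `b` membership in
-- the old R(e).
∨-∧-true : ∀ {a b c} → (a ≡ true → b ≡ true) → a ∨ (b ∧ c) ≡ true → b ≡ true
∨-∧-true {true}  h _ = h refl
∨-∧-true {false} h q = ∧-trueˡ q

infix 4 _≼_ _⊑_

-- Inclusions are records, so that unification can read off the sets.
record _≼_ {n} (X Y : Subset n) : Set where
  constructor ≼-intro
  field included : ∀ i → lookup X i ≡ true → lookup Y i ≡ true

open _≼_

≼-refl : ∀ {n} {X : Subset n} → X ≼ X
≼-refl = ≼-intro λ _ → id

≼-trans : ∀ {n} {X Y Z : Subset n} → X ≼ Y → Y ≼ Z → X ≼ Z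
≼-trans p q = ≼-intro λ i → included q i ∘ included p i

⊥-≼ : ∀ {n} {X : Subset n} → ⊥ ≼ X
⊥-≼ = ≼-intro λ i i∈⊥ → contradiction (lookup⇒[]= i ⊥ i∈⊥) Subset.∉⊥

≼⇒⊆ : ∀ {n} {X Y : Subset n} → X ≼ Y → X ⊆ Y
≼⇒⊆ {Y = Y} X≼Y {i} i∈X = lookup⇒[]= i Y (included X≼Y i ([]=⇒lookup i∈X))

≼⇒∣∣≤ : ∀ {n} {X Y : Subset n} → X ≼ Y → ∣ X ∣ ≤ ∣ Y ∣
≼⇒∣∣≤ {X = X} {Y} X≼Y = Subset.p⊆q⇒∣p∣≤∣q∣ {p = X} {Y} (≼⇒⊆ X≼Y)

-- Under inclusion the only possible disagreement is `true` in `Y` against `false` in `X`, so the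
-- inclusion is proper. All three `Repeat` arguments get their strict decrease from here.
≼∧≢⇒∣∣< : ∀ {n} {X Y : Subset n} → X ≼ Y → ∀ i → lookup Y i ≢ lookup X i → ∣ X ∣ < ∣ Y ∣
≼∧≢⇒∣∣< {X = X} {Y} X≼Y i Y≢X =
  Subset.p⊂q⇒∣p∣<∣q∣ {p = X} {Y}
    ( ≼⇒⊆ X≼Y , i , lookup⇒[]= i Y (proj₁ bits)
    , λ i∈X → contradiction (trans (sym (proj₂ bits)) ([]=⇒lookup i∈X)) λ ())
  where
  bits : lookup Y i ≡ true × lookup X i ≡ false
  bits with lookup Y i | lookup X i | included X≼Y i
  ... | true  | false | _ = refl , refl
  ... | true  | true  | _ = contradiction refl Y≢X
  ... | false | false | _ = contradiction refl Y≢X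
  ... | false | true  | h = contradiction (h refl) λ ()

record _⊑_ {n k} (R R′ : Vec (Subset n) k) : Set where
  constructor ⊑-intro
  field pointwise : ∀ e → lookup R e ≼ lookup R′ e

open _⊑_

⊑-refl : ∀ {n k} {R : Vec (Subset n) k} → R ⊑ R
⊑-refl = ⊑-intro λ _ → ≼-refl

⊑-trans : ∀ {n k} {R R′ R″ : Vec (Subset n) k} → R ⊑ R′ → R′ ⊑ R″ → R ⊑ R″
⊑-trans p q = ⊑-intro λ e → ≼-trans (pointwise p e) (pointwise q e)

⊑-tail : ∀ {n k} {X X′ : Subset n} {R R′ : Vec (Subset n) k} → X ∷ R ⊑ X′ ∷ R′ → R ⊑ R′
⊑-tail p = ⊑-intro λ e → pointwise p (suc e)

size : ∀ {n k} → Vec (Subset n) k → ℕ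
size R = sum (Vec.map ∣_∣ R)

size≤ : ∀ {n k} (R : Vec (Subset n) k) → size R ≤ k * n
size≤ []      = z≤n
size≤ (X ∷ R) = ℕ.+-mono-≤ (Subset.∣p∣≤n X) (size≤ R)

size-mono-≤ : ∀ {n k} (R R′ : Vec (Subset n) k) → R ⊑ R′ → size R ≤ size R′
size-mono-≤ []      []       R⊑R′ = z≤n
size-mono-≤ (_ ∷ R) (_ ∷ R′) R⊑R′ =
  ℕ.+-mono-≤ (≼⇒∣∣≤ (pointwise R⊑R′ zero)) (size-mono-≤ R R′ (⊑-tail R⊑R′))

size-mono-< : ∀ {n k} (R R′ : Vec (Subset n) k) → R ⊑ R′ →
              ∀ e → ∣ lookup R e ∣ < ∣ lookup R′ e ∣ → size R < size R′
size-mono-< (_ ∷ R) (_ ∷ R′) R⊑R′ zero ∣X∣< =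
  ℕ.+-mono-<-≤ ∣X∣< (size-mono-≤ R R′ (⊑-tail R⊑R′))
size-mono-< (_ ∷ R) (_ ∷ R′) R⊑R′ (suc e) ∣X∣< =
  ℕ.+-mono-≤-< (≼⇒∣∣≤ (pointwise R⊑R′ zero)) (size-mono-< R R′ (⊑-tail R⊑R′) e ∣X∣<)

-- Elementary set and array operations.

module _ {G : LabeledMultistageGraph} where
  open LabeledMultistageGraph G

  ∩-runs : ∀ (X Y : Subset ∣E∣) → Runs G (X ∩ₜ Y) (loop #E (con 1 ⊕ (con 1 ⊕ con 1))) (_≼ X)
  ∩-runs X Y = weaken ≼-intro $
    build-runs {P = λ i x → x ≡ true → lookup X i ≡ true} #E ℕ.≤-refl
      λ i → tick $ tick $ return ∧-trueˡ

  ∪-runs : ∀ (X Y : Subset ∣E∣) {Z} → X ≼ Z → Y ≼ Z →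
           Runs G (X ∪ₜ Y) (loop #E (con 1 ⊕ (con 1 ⊕ con 1))) (_≼ Z)
  ∪-runs X Y {Z} X≼Z Y≼Z = weaken ≼-intro $
    build-runs {P = λ i x → x ≡ true → lookup Z i ≡ true} #E ℕ.≤-refl
      λ i → tick $ tick $ return (bit i)
    where
    bit : ∀ i → lookup X i ∨ lookup Y i ≡ true → lookup Z i ≡ true
    bit i with lookup X i | included X≼Z i
    ... | true  | h = λ _ → h refl
    ... | false | _ = included Y≼Z i

  delete-runs : ∀ (X : Subset ∣E∣) i →
                Runs G (write X i false) (loop #E (con 1 ⊕ (con 1 ⊕ con 1))) (_≼ X)
  delete-runs X i = weaken ≼-intro $
    build-runs {P = λ j y → y ≡ true → lookup X j ≡ true} #E ℕ.≤-refl
      λ j → tick $ tick $ return (bit j)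
    where
    bit : ∀ j → (if does (i Fin.≟ j) then false else lookup X j) ≡ true → lookup X j ≡ true
    bit j with does (i Fin.≟ j)
    ... | false = id
    ... | true  = λ ()

  -- The equation at `e` accompanies the inclusion because the measure of `Change` is the size of
  -- the entry just written.
  shrink-runs : ∀ (R : RSets G) e {X} → X ≼ lookup R e →
    Runs G (write R e X) (loop #E (con 1 ⊕ (con 1 ⊕ con 1))) (λ R′ → R′ ⊑ R × lookup R′ e ≡ X)
  shrink-runs R e {X} X≼Re = weaken (λ h → ⊑-intro (λ f → proj₁ (h f)) , proj₂ (h e) refl) $
    build-runs {P = λ f Y → Y ≼ lookup R f × (e ≡ f → Y ≡ X)} #E ℕ.≤-refl
      λ f → tick $ tick $ return (entry f)
    where
    entry : ∀ f → let Y = if does (e Fin.≟ f) then X else lookup R f in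
            Y ≼ lookup R f × (e ≡ f → Y ≡ X)
    entry f with e Fin.≟ f
    ... | yes refl = X≼Re , λ _ → refl
    ... | no  e≢f  = ≼-refl , λ e≡f → contradiction e≡f e≢f

  nonempty-halts : ∀ (X : Subset ∣E∣) → Halts G (nonempty X) (loop #E (con 1 ⊕ con 1))
  nonempty-halts X = any-halts #E ℕ.≤-refl λ i → return tt

  differ-runs : ∀ (X Y : Subset ∣E∣) →
    Runs G (differ X Y) (loop #E ((con 1 ⊕ (con 1 ⊕ con 1)) ⊕ con 1))
      (λ b → b ≡ true → ∃ λ i → lookup X i ≢ lookup Y i)
  differ-runs X Y = any-runs {P = λ i → lookup X i ≢ lookup Y i} #E ℕ.≤-refl
    -- The tested bit is the exclusive or of the two entries, which is `false` when they agree.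
    λ i → tick $ tick $ return λ eq X≡Y → xor-irrefl (lookup Y i)
      (subst (λ x → (x ∧ not (lookup Y i)) ∨ (not x ∧ lookup Y i) ≡ true) X≡Y eq)
    where
    xor-irrefl : ∀ b → (b ∧ not b) ∨ (not b ∧ b) ≢ true
    xor-irrefl true  ()
    xor-irrefl false ()

  onPath⇒∈ : ∀ {ES u v e} {p : Path G ES u v} → _∈edges_ G e p → e ∈ ES
  onPath⇒∈ (here {e∈ES = e∈ES}) = e∈ES
  onPath⇒∈ (there i)            = onPath⇒∈ i

-- Path computations and `Init`.

between-≼ : ∀ G u v ES → Post (between G u v ES) (_≼ ES)
between-≼ G u v ES {x = X} r = ≼-intro λ e e∈X → []=⇒lookup $ onPath⇒∈ $ proj₂ $
  Equivalence.to (between-correct G {ES} {u} {v} r e) (lookup⇒[]= e X e∈X)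

strengthen : ∀ {G} {A} {m : Timed A} {c P Q} → Post m Q → Runs G m c P → Runs G m c Q
strengthen q r = record { halts = halts r ; bound = bound r ; post = q }

-- The cost is quantified before the graph and all inputs, so one expression serves every instance.
-- This pattern is kept throughout and makes the final polynomial uniform.
reachable-halts : ∃ λ c → ∀ G from to ES u → Halts G (reachable G from to ES u) c
reachable-halts = _ , λ G from to ES u →
  bind (build-halts #V ℕ.≤-refl λ w → return tt) λ F₀ _ →
  for-runs #V (L≤∣V∣ G) (λ _ _ _ →
    build-halts #V ℕ.≤-refl λ w →
      tick $
      bind (any-halts #E ℕ.≤-refl λ e →
        tick $ tick $ tick $ tick $ tick $ return tt) λ _ _ →
      return tt) tt

-- The inclusion is taken from the correctness of `between`: each resulting edge lies on a path in
-- `ES`, hence in `ES`. The time bound is derived separately from the program.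
between-runs : ∃ λ c → ∀ G u v ES → Runs G (between G u v ES) c (_≼ ES)
between-runs = _ , λ G u v ES → let open LabeledMultistageGraph G in
  strengthen (between-≼ G u v ES) $
  bind (proj₂ reachable-halts G src tgt ES u) λ F _ →
  bind (proj₂ reachable-halts G tgt src ES v) λ B _ →
  build-halts #E ℕ.≤-refl λ e → tick $ tick $ tick $ tick $ tick $ return tt

hasPath-halts : ∃ λ c → ∀ G u v ES → Halts G (hasPath G u v ES) c
hasPath-halts = _ , λ G u v ES → let open LabeledMultistageGraph G in
  bind (proj₂ reachable-halts G src tgt ES u) λ F _ → return tt

initR-halts : ∃ λ c → ∀ G EL e → Halts G (initR G EL e) c
initR-halts = _ , λ G EL e → let open LabeledMultistageGraph G in
  tick $
  bind (build-halts #E ℕ.≤-refl λ f →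
    tick $ tick $ branch (edgeStage G e <ᵇ edgeStage G f)
      (tick $ tick $ tick $ tick $ tick $ tick $ return tt)
      (return tt)) λ ES _ →
  tick $
  weaken _ $ proj₂ between-runs G (tgt e) D ES

-- The operators `Comp` and `Change`.

Comp-halts : ∃ λ c → ∀ G ES v R → Halts G (Comp G ES v R) c
Comp-halts = _ , λ G ES v R → let open LabeledMultistageGraph G in
  repeat-runs #E ∣_∣ Subset.∣p∣≤n (λ T _ →
    -- The invariant refers to the set `T` at the start of the pass, with which the result is
    -- compared at its end.
    bind (for-runs {P = _≼ T} #E ℕ.≤-refl
      (λ e X X≼T → tick $ branch (lookup X e)
        (tick $
         bind (∩-runs (lookup R e) X) λ Z _ →
         tick $
         bind (proj₂ between-runs G (tgt e) v Z) λ Y _ →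
         bind (proj₂ hasPath-halts G (tgt e) v Y) λ ok _ →
         branch ok (return X≼T)
                   (weaken (λ h → ≼-trans h X≼T) (delete-runs X e)))
        (return X≼T)) ≼-refl) λ T₁ T₁≼T →
    bind (proj₂ between-runs G S v T₁) λ T₂ T₂≼T₁ →
    bind (differ-runs T T₂) λ b diff →
    return (tt , λ b≡true → let (i , T≢T₂) = diff b≡true in
      ≼∧≢⇒∣∣< (≼-trans T₂≼T₁ T₁≼T) i T≢T₂)) tt

keeps-halts : ∃ λ c → ∀ G EL R e f → Halts G (keeps G EL R e f) c
keeps-halts = _ , λ G EL R e f → let open LabeledMultistageGraph G in
  tick $ tick $ tick $
  bind (proj₂ Comp-halts G (lookup EL (tgt f)) (tgt f) R) λ C _ →
  bind (build-halts #E ℕ.≤-refl λ g →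
    tick $ tick $ branch (edgeStage G g <ᵇ edgeStage G e)
      (tick $
       bind (∩-runs (lookup R g) C) λ X _ →
       tick $
       bind (proj₂ between-runs G (tgt g) (tgt f) X) λ Y _ →
       tick $ tick $ return tt)
      (return tt)) λ ES _ →
  tick $
  bind (proj₂ between-runs G S (src e) ES) λ ES′ _ →
  bind (proj₂ Comp-halts G ES′ (src e) R) λ T _ →
  nonempty-halts T

-- Two invariants are nested. Within a pass all families stay below its starting `R₀`, which gives
-- the strict drop of R(e); across passes they stay below the initial `R`, which step 3 needs.
Change-runs : ∃ λ c → ∀ G EL e R → Runs G (Change G EL e R) c (_⊑ R)
Change-runs = _ , λ G EL e R → let open LabeledMultistageGraph G in
  repeat-runs {P = _⊑ R} #E (λ R → ∣ lookup R e ∣) (λ R → Subset.∣p∣≤n (lookup R e)) (λ R₀ R₀⊑R →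
    bind (for-runs {P = _⊑ R₀} #E ℕ.≤-refl
      (λ f R₁ R₁⊑R₀ →
        tick $ tick $ tick $ tick $ tick $
        branch (lookup (lookup R₁ e) f ∧ (edgeStage G e <ᵇ edgeStage G f))
          (bind (proj₂ keeps-halts G EL R₁ e f) λ ok _ →
           branch ok
             (return R₁⊑R₀)
             (bind (delete-runs (lookup R₁ e) f) λ X X≼R₁e →
              weaken (λ (R₂⊑R₁ , _) → ⊑-trans R₂⊑R₁ R₁⊑R₀) (shrink-runs R₁ e X≼R₁e)))
          (return R₁⊑R₀)) ⊑-refl) λ R₁ R₁⊑R₀ →
    tick $ tick $
    bind (proj₂ between-runs G (tgt e) D (lookup R₁ e)) λ X X≼R₁e →
    bind (shrink-runs R₁ e X≼R₁e) λ R₂ (R₂⊑R₁ , R₂e≡X) →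
    tick $
    bind (differ-runs (lookup R₀ e) X) λ b diff →
    return ( ⊑-trans R₂⊑R₁ (⊑-trans R₁⊑R₀ R₀⊑R)
           , λ b≡true → let (i , R₀e≢X) = diff b≡true in
             -- The flag compares the old entry with `X`, while the measure looks at `R₂`; the
             -- equation from `shrink-runs` reconciles them.
             subst (λ Y → ∣ Y ∣ < ∣ lookup R₀ e ∣) (sym R₂e≡X)
               (≼∧≢⇒∣∣< (≼-trans X≼R₁e (pointwise R₁⊑R₀ e)) i R₀e≢X))) ⊑-refl

-- The steps of a sweep and the whole algorithm.

changeStage-runs : ∃ λ c → ∀ G l EL R → Runs G (changeStage G l EL R) c (_⊑ R)
changeStage-runs = _ , λ G l EL R →
  for-runs {P = _⊑ R} #E ℕ.≤-refl (λ e R₁ R₁⊑R →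
    tick $ tick $ branch (edgeStage G e ≡ᵇ l)
      (weaken (λ R₂⊑R₁ → ⊑-trans R₂⊑R₁ R₁⊑R) (proj₂ Change-runs G EL e R₁))
      (return R₁⊑R)) ⊑-refl

compStage-halts : ∃ λ c → ∀ G l R EL → Halts G (compStage G l R EL) c
compStage-halts = _ , λ G l R EL → let open LabeledMultistageGraph G in
  for-runs #V ℕ.≤-refl (λ v EL _ →
    tick $ tick $ branch (toℕ (stage v) ≡ᵇ l)
      (tick $
       bind (proj₂ Comp-halts G (lookup EL v) v R) λ Ev _ →
       build-halts #V ℕ.≤-refl λ w → tick $ tick $ return tt)
      (return tt)) tt

-- Replacing a part of R(e) cannot enlarge it: each set in the union is cut out of an intersection
-- with the current R(e), whatever `Comp` returns, and the other entries are old members.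
updateStage-runs : ∃ λ c → ∀ G l EL R → Runs G (updateStage G l EL R) c (_⊑ R)
updateStage-runs = _ , λ G l EL R → let open LabeledMultistageGraph G in
  for-runs {P = _⊑ R} #E ℕ.≤-refl (λ e R₁ R₁⊑R →
    tick $ tick $ branch (edgeStage G e ≤ᵇ l)
      (tick $
       bind (for-runs {P = _≼ lookup R₁ e} #V ℕ.≤-refl
         (λ v U U≼ →
           tick $ tick $ branch (toℕ (stage v) ≡ᵇ l)
             (tick $ tick $
              bind (proj₂ Comp-halts G (lookup EL v) v R₁) λ C _ →
              bind (∩-runs (lookup R₁ e) C) λ X X≼ →
              tick $
              bind (proj₂ between-runs G (tgt e) v X) λ Y Y≼X →
              ∪-runs U Y U≼ (≼-trans Y≼X X≼))
             (return U≼)) ⊥-≼) λ U U≼ →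
       bind (build-runs {P = λ f x → x ≡ true → lookup (lookup R₁ e) f ≡ true} #E ℕ.≤-refl λ f →
         tick $ tick $ tick $ tick $ tick $
         return λ x → ∨-∧-true (included U≼ f) x) λ X X≼ →
       tick $
       bind (proj₂ between-runs G (tgt e) D X) λ Y Y≼X →
       weaken (λ (R₂⊑R₁ , _) → ⊑-trans R₂⊑R₁ R₁⊑R)
         (shrink-runs R₁ e (≼-trans Y≼X (≼-intro X≼))))
      (return R₁⊑R)) ⊑-refl

sweep-runs : ∃ λ c → ∀ G R EL → Runs G (sweep G (R , EL)) c (λ (R′ , _) → R′ ⊑ R)
sweep-runs = _ , λ G R EL → let open LabeledMultistageGraph G in
  for-runs {P = λ (R′ , _) → R′ ⊑ R} #V (ℕ.≤-trans (ℕ.m∸n≤m L 1) (L≤∣V∣ G)) (λ i (R₀ , EL) R₀⊑R →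
    tick $
    bind (proj₂ changeStage-runs G (suc (toℕ i)) EL R₀) λ R₁ R₁⊑R₀ →
    bind (proj₂ compStage-halts G (suc (toℕ i)) R₁ EL) λ EL₁ _ →
    bind (proj₂ updateStage-runs G (suc (toℕ i)) EL₁ R₁) λ R₂ R₂⊑R₁ →
    return (⊑-trans R₂⊑R₁ (⊑-trans R₁⊑R₀ R₀⊑R))) ⊑-refl

ZH-halts : ∃ λ c → ∀ G → Halts G (ZH G) c
ZH-halts = _ , λ G → let open LabeledMultistageGraph G in
  bind (build-halts #V ℕ.≤-refl λ v → return tt) λ EL _ →
  bind (build-halts #E ℕ.≤-refl (proj₂ initR-halts G EL)) λ R _ →
  -- The measure reads only the R(E) component of the state, matching the change flag; it counts
  -- members of `∣E∣` sets of at most `∣E∣` edges each.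
  bind (repeat-runs (#E ⊗ #E) (λ (R , _) → size R) (λ (R , _) → size≤ R) (λ (R , EL) _ →
    bind (proj₂ sweep-runs G R EL) λ (R′ , _) R′⊑R →
    bind (any-runs {P = λ e → ∃ λ i → lookup (lookup R e) i ≢ lookup (lookup R′ e) i} #E ℕ.≤-refl
      λ e → tick $ tick $ differ-runs (lookup R e) (lookup R′ e)) λ b diff →
    -- One entry loses an edge and none grows, so the total drops. The `⊑` postconditions collected
    -- along the sweep are spent here.
    return (tt , λ b≡true → let (e , i , Re≢R′e) = diff b≡true in
      size-mono-< R′ R R′⊑R e (≼∧≢⇒∣∣< (pointwise R′⊑R e) i Re≢R′e))) tt) λ (R′ , EL′) _ →
  tick $
  bind (proj₂ Comp-halts G (lookup EL′ D) D R′) λ T _ →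
  nonempty-halts T

theorem1 : ∃ λ (p : List ℕ) → (G : LabeledMultistageGraph) → let open LabeledMultistageGraph G in
    1 ≤ ∣V∣ * ∣E∣ → HaltsWithin (ZH G) (⟦ p ⟧ (∣V∣ * ∣E∣))
theorem1 = polynomial (proj₁ ZH-halts) , λ G pos →
  let r = proj₂ ZH-halts G in
  halts r , λ t x e → ℕ.≤-trans (bound r e) (at≤polynomial G pos (proj₁ ZH-halts))
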